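{- Let $\kappa$ be a supercompact cardinal. Then every reflexive abelian group $H$ of cardinality $\geq \kappa$ has arbitrarily large direct summands of cardinality $< \kappa$; that is, for every cardinal $\chi < \kappa$ there is a direct summand $H'$ of $H$ with $\chi \leq |H'| < \kappa$.
   Context: For an abelian group $G$, $G^* = \operatorname{Hom}(G,\mathbb{Z})$ denotes its dual group. $G$ is reflexive if the evaluation map $\sigma : G \to G^{**}$, $\sigma(g)(\varphi) = \varphi(g)$ for $\varphi\in G^*$, is an isomorphism. -}

module Defs where

open import Level using (Level; Lift; _⊔_; suc)
open import Algebra.Bundles using (AbelianGroup)
open import Algebra.Morphism.Bundles using (GroupHomomorphism)
open import Algebra.Morphism.Structures using (module GroupMorphisms)
open import Data.Bool.Base using (Bool; T)
open import Data.Integer.Base using (ℤ; 0ℤ; -_) renaming (_+_ to _+ℤ_)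
import Data.Integer.Properties as ℤ
open import Data.Nat.Base using (ℕ)
open import Data.Product.Base using (Σ; ∃; ∃-syntax; _×_; _,_; proj₁; proj₂)
open import Data.Refinement using (Refinement-syntax; value)
open import Data.Sum.Base using (_⊎_)
open import Function.Bundles using (Injection)
open import Relation.Binary.Bundles using (Setoid)
import Relation.Binary.Construct.On as On
open import Relation.Binary.PropositionalEquality
  using (_≡_; refl; sym; trans; cong; cong₂; setoid)
open import Relation.Nullary using (¬_)
open import Relation.Unary using (Pred; ∁; _∈_; _⊆_; _∩_; ⋂)
open import Relation.Unary.Polymorphic using (∅; U)

private
  variable
    a b c ℓ ℓ₁ ℓ₂ : Level

------------------------------------------------------------------------
-- Cardinality
--
-- A cardinal is represented by any type of that cardinality; cardinals
-- enter only through the comparisons below.  These, and the large-cardinal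
-- notions built on them, have their usual meaning in the presence of
-- Axiom.ExcludedMiddle (which, deciding types rather than propositions,
-- also supplies choice) and function extensionality.

infix 4 _≼_ _≺_

_≼_ : Setoid a ℓ₁ → Setoid b ℓ₂ → Set (a ⊔ b ⊔ ℓ₁ ⊔ ℓ₂)
A ≼ B = Injection A B

_≺_ : Setoid a ℓ₁ → Setoid b ℓ₂ → Set (a ⊔ b ⊔ ℓ₁ ⊔ ℓ₂)
A ≺ B = A ≼ B × ¬ (B ≼ A)

-- Equality on the subset compares underlying elements only, so different
-- membership proofs do not contribute to its cardinality.
subsetoid : (S : Setoid a ℓ) → Pred (Setoid.Carrier S) b → Setoid (a ⊔ b) ℓ
subsetoid S P = On.setoid {B = Σ (Setoid.Carrier S) P} S proj₁

------------------------------------------------------------------------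
-- Supercompact cardinals

⟦_⟧ᵇ : {X : Set ℓ} → (X → Bool) → Pred X ℓ
⟦ P ⟧ᵇ x = Lift _ (T (P x))

-- 𝒫 κ X is P_κ(X), the set of subsets of X of cardinality < κ.  Its points
-- are characteristic functions with an irrelevant size bound, so that,
-- given function extensionality, points with the same elements are equal.
-- Under excluded middle every predicate on X has a characteristic function.
𝒫 : Set ℓ → Set ℓ → Set ℓ
𝒫 κ X = [ P ∈ (X → Bool) ∣ subsetoid (setoid X) ⟦ P ⟧ᵇ ≺ setoid κ ]

elements : {κ X : Set ℓ} → 𝒫 κ X → Pred X ℓ
elements P = ⟦ value P ⟧ᵇ

record IsUltrafilter {A : Set ℓ} (𝓤 : Pred (Pred A ℓ) ℓ) : Set (suc ℓ) where
  field
    full   : U ∈ 𝓤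
    proper : ¬ (∅ ∈ 𝓤)
    upward : ∀ {S S′} → S ⊆ S′ → S ∈ 𝓤 → S′ ∈ 𝓤
    inter  : ∀ {S S′} → S ∈ 𝓤 → S′ ∈ 𝓤 → S ∩ S′ ∈ 𝓤
    ultra  : ∀ S → S ∈ 𝓤 ⊎ ∁ S ∈ 𝓤

IsComplete : (κ : Set ℓ) {A : Set ℓ} → Pred (Pred A ℓ) ℓ → Set (suc ℓ)
IsComplete {ℓ} κ {A} 𝓤 =
  (I : Set ℓ) → setoid I ≺ setoid κ →
  (S : I → Pred A ℓ) → (∀ i → S i ∈ 𝓤) → ⋂ I S ∈ 𝓤

record IsNormalMeasure (κ X : Set ℓ) (𝓤 : Pred (Pred (𝒫 κ X) ℓ) ℓ) :
                       Set (suc ℓ) where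
  field
    isUltrafilter : IsUltrafilter 𝓤
    complete      : IsComplete κ 𝓤
    fine          : ∀ x → (λ P → x ∈ elements P) ∈ 𝓤
    normal        : (f : 𝒫 κ X → X) → (λ P → f P ∈ elements P) ∈ 𝓤 →
                    ∃[ x ] (λ P → f P ≡ x) ∈ 𝓤

  open IsUltrafilter isUltrafilter public

-- The combinatorial definition of supercompactness (Solovay): a normal fine
-- measure on P_κ(X) for every set X of cardinality ≥ κ.
record IsSupercompact (κ : Set ℓ) : Set (suc ℓ) where
  field
    uncountable : setoid ℕ ≺ setoid κ
    measure     : (X : Set ℓ) → setoid κ ≼ setoid X →
                  ∃[ 𝓤 ] IsNormalMeasure κ X 𝓤

------------------------------------------------------------------------
-- Dual groups and reflexivity

open GroupHomomorphism using (⟦_⟧; ⟦⟧-cong; homo; ε-homo; ⁻¹-homo)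

module _ (G : AbelianGroup c ℓ) where
  open AbelianGroup G using (Carrier; _≈_; _∙_; ε; _⁻¹; rawGroup)

  Hom-ℤ : Set (c ⊔ ℓ)
  Hom-ℤ = GroupHomomorphism rawGroup
                            (AbelianGroup.rawGroup ℤ.+-0-abelianGroup)

  private
    interchange : ∀ i j k l → (i +ℤ j) +ℤ (k +ℤ l) ≡ (i +ℤ k) +ℤ (j +ℤ l)
    interchange i j k l =
      trans (ℤ.+-assoc i j (k +ℤ l))
      (trans (cong (i +ℤ_) (trans (sym (ℤ.+-assoc j k l))
             (trans (cong (_+ℤ l) (ℤ.+-comm j k)) (ℤ.+-assoc k j l))))
             (sym (ℤ.+-assoc i k (j +ℤ l))))

    mkHom : (f : Carrier → ℤ) → (∀ {x y} → x ≈ y → f x ≡ f y) →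
            (∀ x y → f (x ∙ y) ≡ f x +ℤ f y) → f ε ≡ 0ℤ →
            (∀ x → f (x ⁻¹) ≡ - f x) → Hom-ℤ
    mkHom f f-cong f-homo f-ε f-⁻¹ = record
      { ⟦_⟧ = f
      ; isGroupHomomorphism = record
        { isMonoidHomomorphism = record
          { isMagmaHomomorphism = record
            { isRelHomomorphism = record { cong = f-cong }
            ; homo = f-homo
            }
          ; ε-homo = f-ε
          }
        ; ⁻¹-homo = f-⁻¹
        }
      }

    _⊕_ : Hom-ℤ → Hom-ℤ → Hom-ℤ
    φ ⊕ ψ = mkHom (λ x → ⟦ φ ⟧ x +ℤ ⟦ ψ ⟧ x)
      (λ x≈y → cong₂ _+ℤ_ (⟦⟧-cong φ x≈y) (⟦⟧-cong ψ x≈y))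
      (λ x y → trans (cong₂ _+ℤ_ (homo φ x y) (homo ψ x y))
                     (interchange (⟦ φ ⟧ x) (⟦ φ ⟧ y) (⟦ ψ ⟧ x) (⟦ ψ ⟧ y)))
      (cong₂ _+ℤ_ (ε-homo φ) (ε-homo ψ))
      (λ x → trans (cong₂ _+ℤ_ (⁻¹-homo φ x) (⁻¹-homo ψ x))
                   (sym (ℤ.neg-distrib-+ (⟦ φ ⟧ x) (⟦ ψ ⟧ x))))

    𝟘 : Hom-ℤ
    𝟘 = mkHom (λ _ → 0ℤ) (λ _ → refl) (λ _ _ → refl) refl (λ _ → refl)

    ⊖_ : Hom-ℤ → Hom-ℤ
    ⊖ φ = mkHom (λ x → - ⟦ φ ⟧ x)
      (λ x≈y → cong -_ (⟦⟧-cong φ x≈y))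
      (λ x y → trans (cong -_ (homo φ x y))
                     (ℤ.neg-distrib-+ (⟦ φ ⟧ x) (⟦ φ ⟧ y)))
      (cong -_ (ε-homo φ))
      (λ x → cong -_ (⁻¹-homo φ x))

  dual : AbelianGroup (c ⊔ ℓ) c
  dual = record
    { Carrier = Hom-ℤ
    ; _≈_     = λ φ ψ → ∀ x → ⟦ φ ⟧ x ≡ ⟦ ψ ⟧ x
    ; _∙_     = _⊕_
    ; ε       = 𝟘
    ; _⁻¹     = ⊖_
    ; isAbelianGroup = record
      { isGroup = record
        { isMonoid = record
          { isSemigroup = record
            { isMagma = record
              { isEquivalence = record
                { refl  = λ _ → refl
                ; sym   = λ p x → sym (p x)
                ; trans = λ p q x → trans (p x) (q x)
                }
              ; ∙-cong = λ p q x → cong₂ _+ℤ_ (p x) (q x)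
              }
            ; assoc = λ φ ψ χ x → ℤ.+-assoc (⟦ φ ⟧ x) (⟦ ψ ⟧ x) (⟦ χ ⟧ x)
            }
          ; identity = (λ φ x → ℤ.+-identityˡ (⟦ φ ⟧ x))
                     , (λ φ x → ℤ.+-identityʳ (⟦ φ ⟧ x))
          }
        ; inverse = (λ φ x → ℤ.+-inverseˡ (⟦ φ ⟧ x))
                  , (λ φ x → ℤ.+-inverseʳ (⟦ φ ⟧ x))
        ; ⁻¹-cong = λ p x → cong -_ (p x)
        }
      ; comm = λ φ ψ x → ℤ.+-comm (⟦ φ ⟧ x) (⟦ ψ ⟧ x)
      }
    }

module _ (G : AbelianGroup c ℓ) where
  open AbelianGroup G using (Carrier; rawGroup)

  evaluation : Carrier → AbelianGroup.Carrier (dual (dual G))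
  evaluation g = record
    { ⟦_⟧ = λ φ → ⟦ φ ⟧ g
    ; isGroupHomomorphism = record
      { isMonoidHomomorphism = record
        { isMagmaHomomorphism = record
          { isRelHomomorphism = record { cong = λ φ≈ψ → φ≈ψ g }
          ; homo = λ _ _ → refl
          }
        ; ε-homo = refl
        }
      ; ⁻¹-homo = λ _ → refl
      }
    }

  IsReflexive : Set (c ⊔ ℓ)
  IsReflexive = IsGroupIsomorphism evaluation
    where open GroupMorphisms rawGroup
                              (AbelianGroup.rawGroup (dual (dual G)))

------------------------------------------------------------------------
-- Direct summands

module _ (G : AbelianGroup c ℓ) where
  open AbelianGroup G using (Carrier; _≈_; _∙_; ε; _⁻¹)

  record IsSubgroup (A : Pred Carrier a) : Set (c ⊔ ℓ ⊔ a) where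
    field
      resp      : ∀ {x y} → x ≈ y → x ∈ A → y ∈ A
      ε-closed  : ε ∈ A
      ∙-closed  : ∀ {x y} → x ∈ A → y ∈ A → x ∙ y ∈ A
      ⁻¹-closed : ∀ {x} → x ∈ A → x ⁻¹ ∈ A

  -- G is the internal direct sum of A and B.
  record IsInternalSum (A : Pred Carrier a) (B : Pred Carrier b) :
                       Set (c ⊔ ℓ ⊔ a ⊔ b) where
    field
      subgroupˡ : IsSubgroup A
      subgroupʳ : IsSubgroup B
      spans     : ∀ g → ∃[ x ] ∃[ y ] x ∈ A × y ∈ B × g ≈ x ∙ y
      disjoint  : ∀ {x} → x ∈ A → x ∈ B → x ≈ ε

  IsDirectSummand : Pred Carrier a → Set (c ⊔ ℓ ⊔ suc a)
  IsDirectSummand {a} A = ∃[ B ] IsInternalSum {b = a} A B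

{-# OPTIONS --safe #-}
module Submission where

-- The ultrapower argument is carried out inside P_κ(X), X = H ⊎ H*, with a
-- normal fine measure.  Let x_P ∈ H be given for each P.  By countable
-- completeness each φ ∈ H* is constant on almost all x_P, and φ ↦ this constant
-- is an element of H**, hence evaluation at some h ∈ H.  Normality then gives,
-- for almost all P, that h lies in P and that φ (x_P) = φ h for all φ ∈ P at
-- once.  So for almost all P every x ∈ H is congruent to an element of P ∩ H
-- modulo the common kernel of P ∩ H*, and P ∩ H is a direct summand with that
-- kernel as its complement.

open import Defs
open import Algebra.Bundles using (AbelianGroup)
open import Algebra.Morphism.Bundles using (GroupHomomorphism)
open import Algebra.Morphism.Structures using (module GroupMorphisms)
import Algebra.Properties.AbelianGroup as AbelianGroupProperties
open import Axiom.ExcludedMiddle using (ExcludedMiddle)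
open import Axiom.Extensionality.Propositional
  using (Extensionality; lower-extensionality)
open import Data.Bool.Base using (Bool; T)
open import Data.Integer.Base using (ℤ; 0ℤ; +_; -_; ∣_∣) renaming (_+_ to _+ℤ_)
import Data.Integer.Properties as ℤ
open import Data.Irrelevant using ([_])
open import Data.Nat.Base using (ℕ)
open import Data.Product.Base using (∃; ∃-syntax; _×_; _,_; proj₁; proj₂)
open import Data.Refinement using (_,_)
open import Data.Sum.Base as Sum using (_⊎_; inj₁; inj₂; fromInj₁; fromInj₂)
open import Data.Sum.Properties using (inj₁-injective)
open import Function.Base using (_∘_; const)
open import Function.Bundles using (Injection; mk↣)
import Function.Construct.Composition as Composition
open import Level using (Level; Lift; lift; lower)
open import Relation.Binary.Bundles using (Setoid)
open import Relation.Binary.PropositionalEquality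
  using (_≡_; refl; sym; trans; cong; cong₂; subst; setoid; module ≡-Reasoning)
open import Relation.Nullary using (¬_; yes; no; contradiction)
open import Relation.Nullary.Decidable
  using (⌊_⌋; decidable-stable; recompute; toWitness; fromWitness)
open import Relation.Unary using (Pred; _∈_; ∁)
open import Relation.Unary.Polymorphic using (U)

private
  variable
    a b c ℓ ℓ₁ ℓ₂ ℓ₃ : Level

-- Cardinal comparison, choice and canonical representatives.

≼-trans : {A : Setoid a ℓ₁} {B : Setoid b ℓ₂} {C : Setoid c ℓ₃} →
          A ≼ B → B ≼ C → A ≼ C
≼-trans = Composition.injection

≼-≺-trans : {A : Setoid a ℓ₁} {B : Setoid b ℓ₂} {C : Setoid c ℓ₃} →
            A ≼ B → B ≺ C → A ≺ C
≼-≺-trans {A = A} {B} {C} A≼B (B≼C , C⋠B) =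
  ≼-trans {A = A} {B} {C} A≼B B≼C ,
  λ C≼A → C⋠B (≼-trans {A = C} {A} {B} C≼A A≼B)

-- Excluded middle decides types, so its `yes` case hands over an actual witness; `default` fills in
-- where there is none.
choice : ExcludedMiddle ℓ → {A B : Set ℓ} (R : A → B → Set ℓ) → B →
         ∃[ f ] (∀ x → ∃ (R x) → R x (f x))
choice em {A} {B} R default = f , f-spec
  where
  f : A → B
  f x with em {∃ (R x)}
  ... | yes (y , _) = y
  ... | no  _       = default

  f-spec : ∀ x → ∃ (R x) → R x (f x)
  f-spec x ∃y with em {∃ (R x)}
  ... | yes (_ , r) = r
  ... | no  ∄y      = contradiction ∃y ∄y

-- The class of x is encoded as a Bool-valued function so that, by function
-- extensionality, equivalent elements have equal classes.
representatives : ExcludedMiddle ℓ → Extensionality ℓ ℓ → (S : Setoid ℓ ℓ) →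
                  let open Setoid S in Carrier →
                  ∃[ r ] (∀ x → x ≈ r x) × (∀ {x y} → x ≈ y → r x ≡ r y)
representatives {ℓ} em ext S default = r , ≈r , r-cong
  where
  open Setoid S renaming (refl to ≈-refl; sym to ≈-sym; trans to ≈-trans)

  class : Carrier → Carrier → Bool
  class x y = ⌊ em {x ≈ y} ⌋

  class-cong : ∀ {x y} → x ≈ y → ∀ z → class x z ≡ class y z
  class-cong {x} {y} x≈y z with em {x ≈ z} | em {y ≈ z}
  ... | yes _   | yes _   = refl
  ... | yes x≈z | no  y≉z = contradiction (≈-trans (≈-sym x≈y) x≈z) y≉z
  ... | no  x≉z | yes y≈z = contradiction (≈-trans x≈y y≈z) x≉z
  ... | no  _   | no  _   = refl

  element : ∃[ f ] ((B : Carrier → Bool) → (∃ λ y → Lift ℓ (T (B y))) →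
                    Lift ℓ (T (B (f B))))
  element = choice em (λ B y → Lift ℓ (T (B y))) default

  r : Carrier → Carrier
  r x = proj₁ element (class x)

  ≈r : ∀ x → x ≈ r x
  ≈r x = toWitness (lower (proj₂ element (class x)
                             (x , lift (fromWitness ≈-refl))))

  r-cong : ∀ {x y} → x ≈ y → r x ≡ r y
  r-cong x≈y = cong (proj₁ element) (lower-extensionality ℓ ℓ ext (class-cong x≈y))

-- Ultrafilters and countable completeness.

module _ (em : ExcludedMiddle ℓ) {A : Set ℓ} {𝓤 : Pred (Pred A ℓ) ℓ}
         (isUltrafilter : IsUltrafilter 𝓤) where

  open IsUltrafilter isUltrafilter

  nonempty : ∀ {S} → S ∈ 𝓤 → ∃ S
  nonempty S∈𝓤 = decidable-stable em λ ∄ →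
    proper (upward (λ {x} x∈S → lift (∄ (x , x∈S))) S∈𝓤)

  module _ {κ : Set ℓ} (ℕ≺κ : setoid ℕ ≺ setoid κ)
           (complete : IsComplete κ 𝓤) where

    -- If no fibre of `g` were in `𝓤`, all their complements would be, and so would the countable
    -- intersection of these. A point `x` of it would avoid its own value `g x`.
    ℕ-constant : (g : A → ℕ) → ∃[ n ] (λ x → Lift ℓ (g x ≡ n)) ∈ 𝓤
    ℕ-constant g = decidable-stable em λ nowhere →
      let avoids = λ n → fromInj₂ (λ g≡n → contradiction (n , g≡n) nowhere)
                                  (ultra (λ x → Lift ℓ (g x ≡ n)))
          x , g≢ = nonempty (complete (Lift ℓ ℕ) Liftℕ≺κ
                              (λ (lift n) → ∁ (λ x → Lift ℓ (g x ≡ n)))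
                              (λ (lift n) → avoids n))
      in g≢ (lift (g x)) (lift refl)
      where
      Liftℕ≺κ : setoid (Lift ℓ ℕ) ≺ setoid κ
      Liftℕ≺κ = ≼-≺-trans {A = setoid (Lift ℓ ℕ)} {setoid ℕ} {setoid κ}
                          (mk↣ (cong lift)) ℕ≺κ

    -- The absolute value is almost everywhere constant, and the ultrafilter then decides the sign.
    ℤ-constant : (g : A → ℤ) → ∃[ i ] (λ x → Lift ℓ (g x ≡ i)) ∈ 𝓤
    ℤ-constant g with ℕ-constant (∣_∣ ∘ g)
    ... | n , ∣g∣≡n with ultra (λ x → Lift ℓ (g x ≡ + n))
    ...   | inj₁ g≡+n = + n , g≡+n
    ...   | inj₂ g≢+n = - (+ n) , upward negative (inter ∣g∣≡n g≢+n)
      where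
      negative : ∀ {x} → Lift ℓ (∣ g x ∣ ≡ n) × ¬ Lift ℓ (g x ≡ + n) →
                 Lift ℓ (g x ≡ - (+ n))
      negative {x} (lift refl , gx≢) with ℤ.+∣i∣≡i⊎+∣i∣≡-i (g x)
      ... | inj₁ eq = contradiction (lift (sym eq)) gx≢
      ... | inj₂ eq = lift (trans (sym (ℤ.neg-involutive (g x)))
                                  (cong -_ (sym eq)))

-- Normality as closure under diagonal intersections.

module _ (em : ExcludedMiddle ℓ) {κ X : Set ℓ}
         {𝓤 : Pred (Pred (𝒫 κ X) ℓ) ℓ} (μ : IsNormalMeasure κ X 𝓤) where

  open IsNormalMeasure μ

  -- Otherwise almost every `P` has a counterexample `f P` in `P`. By normality `f` is almost
  -- everywhere some fixed `x`, so almost every `P` lies outside `D x`, against `D x ∈ 𝓤`.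
  diagonal : X → (D : X → Pred (𝒫 κ X) ℓ) → (∀ x → D x ∈ 𝓤) →
             (λ P → ∀ x → x ∈ elements P → D x P) ∈ 𝓤
  diagonal default D D∈𝓤 = fromInj₁ (λ ∁Δ∈𝓤 → contradiction ∁Δ∈𝓤 ∁Δ∉𝓤)
                                    (ultra Δ)
    where
    Δ : Pred (𝒫 κ X) ℓ
    Δ P = ∀ x → x ∈ elements P → D x P

    Counterexample : 𝒫 κ X → Pred X ℓ
    Counterexample P x = x ∈ elements P × ¬ D x P

    selection : ∃[ f ] (∀ P → ∃ (Counterexample P) → Counterexample P (f P))
    selection = choice em Counterexample default

    f : 𝒫 κ X → X
    f = proj₁ selection

    counterexample : ∀ {P} → P ∈ ∁ Δ → Counterexample P (f P)
    counterexample {P} P∉Δ = proj₂ selection P (decidable-stable em λ ∄ →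
      P∉Δ λ x x∈P → decidable-stable em λ P∉Dx → ∄ (x , x∈P , P∉Dx))

    ∁Δ∉𝓤 : ¬ (∁ Δ ∈ 𝓤)
    ∁Δ∉𝓤 ∁Δ∈𝓤 =
      let x , f≡x = normal f (upward (λ {P} P∉Δ → proj₁ (counterexample {P} P∉Δ))
                                     ∁Δ∈𝓤)
          P , (P∉Δ , fP≡x) , P∈Dx =
            nonempty em isUltrafilter (inter (inter ∁Δ∈𝓤 f≡x) (D∈𝓤 x))
      in contradiction (subst (λ y → D y P) (sym fP≡x) P∈Dx)
                       (proj₂ (counterexample {P} P∉Δ))

-- Consequences of reflexivity: separation and limits along an ultrafilter.

module _ (em : ExcludedMiddle ℓ) (H : AbelianGroup ℓ ℓ)
         (reflexive : IsReflexive H) where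

  open AbelianGroup H
    using (Carrier; _≈_; _∙_; ε; _⁻¹; _-_; ∙-cong; ⁻¹-cong)
    renaming (setoid to H-setoid; sym to ≈-sym; trans to ≈-trans)
  open AbelianGroupProperties H using (xyx⁻¹≈y)
  open GroupHomomorphism using (⟦_⟧; ⟦⟧-cong; homo; ε-homo; ⁻¹-homo)
  open GroupMorphisms (AbelianGroup.rawGroup H)
                      (AbelianGroup.rawGroup (dual (dual H)))
  open IsGroupIsomorphism reflexive using (injective; surjective)

  -- This is injectivity of evaluation, read contrapositively.
  separation : ∀ {x} → ¬ x ≈ ε → ∃[ φ ] ¬ ⟦ φ ⟧ x ≡ 0ℤ
  separation x≉ε = decidable-stable em λ ∄φ → x≉ε (injective λ φ →
    trans (decidable-stable (_ ℤ.≟ _) λ φx≢0 → ∄φ (φ , φx≢0))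
          (sym (ε-homo φ)))

  -- The almost-everywhere value of `φ` along `f` is additive in `φ`: each homomorphism law involves
  -- finitely many `φ`, so it can be checked at one point `a` where all of them take their limit
  -- values. Surjectivity of evaluation turns this functional into `h`.
  limit : {A : Set ℓ} {𝓤 : Pred (Pred A ℓ) ℓ} → IsUltrafilter 𝓤 →
          {κ : Set ℓ} → setoid ℕ ≺ setoid κ → IsComplete κ 𝓤 →
          (f : A → Carrier) →
          ∃[ h ] (∀ φ → (λ a → Lift ℓ (⟦ φ ⟧ (f a) ≡ ⟦ φ ⟧ h)) ∈ 𝓤)
  limit {A} {𝓤} isUltrafilter ℕ≺κ complete f =
    h , λ φ → subst (λ n → (λ a → Lift ℓ (⟦ φ ⟧ (f a) ≡ n)) ∈ 𝓤)
                    (sym (evaluation≈Φ φ)) (proj₂ (value φ))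
    where
    open IsUltrafilter isUltrafilter

    value : (φ : Hom-ℤ H) → ∃[ n ] (λ a → Lift ℓ (⟦ φ ⟧ (f a) ≡ n)) ∈ 𝓤
    value φ = ℤ-constant em isUltrafilter ℕ≺κ complete (⟦ φ ⟧ ∘ f)

    open AbelianGroup (dual H) using ()
      renaming (_≈_ to _≈*_; _∙_ to _∙*_; ε to ε*; _⁻¹ to _⁻¹*)

    lim : Hom-ℤ H → ℤ
    lim φ = proj₁ (value φ)

    lim-cong : ∀ {φ ψ} → φ ≈* ψ → lim φ ≡ lim ψ
    lim-cong {φ} {ψ} φ≈ψ =
      let a , lift p , lift q = nonempty em isUltrafilter
            (inter (proj₂ (value φ)) (proj₂ (value ψ)))
      in trans (sym p) (trans (φ≈ψ (f a)) q)

    lim-homo : ∀ φ ψ → lim (φ ∙* ψ) ≡ lim φ +ℤ lim ψ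
    lim-homo φ ψ =
      let a , (lift p , lift q) , lift r = nonempty em isUltrafilter
            (inter (inter (proj₂ (value φ)) (proj₂ (value ψ)))
                   (proj₂ (value (φ ∙* ψ))))
      in trans (sym r) (cong₂ _+ℤ_ p q)

    lim-ε : lim ε* ≡ 0ℤ
    lim-ε = let _ , lift p = nonempty em isUltrafilter (proj₂ (value ε*))
            in sym p

    lim-⁻¹ : ∀ φ → lim (φ ⁻¹*) ≡ - lim φ
    lim-⁻¹ φ =
      let a , lift p , lift q = nonempty em isUltrafilter
            (inter (proj₂ (value φ)) (proj₂ (value (φ ⁻¹*))))
      in trans (sym q) (cong -_ p)

    Φ : Hom-ℤ (dual H)
    Φ = record
      { ⟦_⟧ = lim
      ; isGroupHomomorphism = record
        { isMonoidHomomorphism = record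
          { isMagmaHomomorphism = record
            { isRelHomomorphism = record
              { cong = λ {φ} {ψ} → lim-cong {φ} {ψ} }
            ; homo = lim-homo
            }
          ; ε-homo = lim-ε
          }
        ; ⁻¹-homo = lim-⁻¹
        }
      }

    h : Carrier
    h = proj₁ (surjective Φ)

    evaluation≈Φ : ∀ φ → ⟦ φ ⟧ h ≡ lim φ
    evaluation≈Φ = proj₂ (surjective Φ) (AbelianGroup.refl H)

  -- Almost every `P` cuts out a direct summand.

  module _ (ext : Extensionality ℓ ℓ) {κ : Set ℓ}
           (ℕ≺κ : setoid ℕ ≺ setoid κ)
           {𝓤 : Pred (Pred (𝒫 κ (Carrier ⊎ Hom-ℤ H)) ℓ) ℓ}
           (μ : IsNormalMeasure κ (Carrier ⊎ Hom-ℤ H) 𝓤) where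

    open IsNormalMeasure μ

    private
      X : Set ℓ
      X = Carrier ⊎ Hom-ℤ H

      canonical : ∃[ r ] (∀ x → x ≈ r x) × (∀ {x y} → x ≈ y → r x ≡ r y)
      canonical = representatives em ext H-setoid ε

      r : Carrier → Carrier
      r = proj₁ canonical

      ≈r : ∀ x → x ≈ r x
      ≈r = proj₁ (proj₂ canonical)

      r-cong : ∀ {x y} → x ≈ y → r x ≡ r y
      r-cong = proj₂ (proj₂ canonical)

    -- P ∩ H has to be closed under _≈_ without growing beyond the size of P:
    -- only canonical representatives are tested for membership.
    trace : 𝒫 κ X → Pred Carrier ℓ
    trace P x = inj₁ (r x) ∈ elements P

    annihilator : 𝒫 κ X → Pred Carrier ℓ
    annihilator P x = ∀ φ → inj₂ φ ∈ elements P → ⟦ φ ⟧ x ≡ 0ℤ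

    trace-resp : ∀ P {x y} → x ≈ y → x ∈ trace P → y ∈ trace P
    trace-resp P x≈y = subst (λ z → inj₁ z ∈ elements P) (r-cong x≈y)

    trace≺κ : ∀ P → subsetoid H-setoid (trace P) ≺ setoid κ
    trace≺κ P@(_ , [ small ]) =
      ≼-≺-trans {A = subsetoid H-setoid (trace P)}
                {subsetoid (setoid X) (elements P)} {setoid κ}
        (record
          { to        = λ (x , x∈P) → inj₁ (r x) , x∈P
          ; cong      = cong inj₁ ∘ r-cong
          ; injective = λ {(x , _)} {(y , _)} eq →
              ≈-trans (≈r x)
                (≈-trans (AbelianGroup.reflexive H (inj₁-injective eq))
                         (≈-sym (≈r y)))
          })
        -- The size bound stored in a point of `𝒫` is irrelevant; deciding it by `em` makes it
        -- usable.
        (recompute em small)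

    diagonalᴴ : (D : Carrier → Pred (𝒫 κ X) ℓ) → (∀ x → D x ∈ 𝓤) →
                (λ P → ∀ x → inj₁ x ∈ elements P → D x P) ∈ 𝓤
    diagonalᴴ D D∈𝓤 = upward (λ Δ x → Δ (inj₁ x))
      -- The other half of `X` gets the trivial condition `U`.
      (diagonal em μ (inj₁ ε) Sum.[ D , const U ] Sum.[ D∈𝓤 , const full ])

    diagonal* : (D : Hom-ℤ H → Pred (𝒫 κ X) ℓ) → (∀ φ → D φ ∈ 𝓤) →
                (λ P → ∀ φ → inj₂ φ ∈ elements P → D φ P) ∈ 𝓤
    diagonal* D D∈𝓤 = upward (λ Δ φ → Δ (inj₂ φ))
      (diagonal em μ (inj₁ ε) Sum.[ const U , D ] Sum.[ const full , D∈𝓤 ])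

    -- For fixed `x` and `y`, fineness puts the representative of the product into almost every `P`;
    -- two diagonal intersections then let `x` and `y` range over `P`.
    ∙-closed-ae : (λ P → ∀ x → x ∈ trace P → ∀ y → y ∈ trace P →
                         x ∙ y ∈ trace P) ∈ 𝓤
    ∙-closed-ae = upward
      (λ {P} Δ x x∈P y y∈P → trace-resp P (∙-cong (≈-sym (≈r x)) (≈-sym (≈r y)))
                                           (Δ (r x) x∈P (r y) y∈P))
      (diagonalᴴ _ λ x → diagonalᴴ _ λ y → fine (inj₁ (r (x ∙ y))))

    ⁻¹-closed-ae : (λ P → ∀ x → x ∈ trace P → x ⁻¹ ∈ trace P) ∈ 𝓤
    ⁻¹-closed-ae = upward
      (λ {P} Δ x x∈P → trace-resp P (⁻¹-cong (≈-sym (≈r x))) (Δ (r x) x∈P))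
      (diagonalᴴ _ λ x → fine (inj₁ (r (x ⁻¹))))

    -- A fixed nonzero `x` is detected by some `φ`, which by fineness belongs to almost every `P`; a
    -- diagonal intersection handles all `x` in `P` at once.
    disjoint-ae : (λ P → ∀ x → x ∈ trace P → x ∈ annihilator P → x ≈ ε) ∈ 𝓤
    disjoint-ae = upward
      (λ Δ x x∈P x⊥P → ≈-trans (≈r x) (Δ (r x) x∈P λ φ φ∈P →
        trans (⟦⟧-cong φ (≈-sym (≈r x))) (x⊥P φ φ∈P)))
      (diagonalᴴ (λ x P → x ∈ annihilator P → x ≈ ε) detected)
      where
      detected : ∀ x → (λ P → x ∈ annihilator P → x ≈ ε) ∈ 𝓤
      detected x with em {x ≈ ε}
      ... | yes x≈ε = upward (λ _ _ → x≈ε) full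
      ... | no  x≉ε = let φ , φx≢0 = separation x≉ε in
        upward (λ φ∈P x⊥P → contradiction (x⊥P φ φ∈P) φx≢0) (fine (inj₂ φ))

    spans-ae : (λ P → ∀ x → ∃[ y ] y ∈ trace P × (x - y) ∈ annihilator P) ∈ 𝓤
    spans-ae =
      -- `f P` is an element without a decomposition whenever `P` has one. The limit `h` of `f`
      -- would decompose it for almost every `P`, so almost no `P` has one.
      let f , f-spec = choice em (λ P x → ¬ Decomposes P x) ε
          h , φf≡φh  = limit isUltrafilter ℕ≺κ complete f
      in upward
        (λ {P} (h∈P , agree) x → decidable-stable em λ undecomposable →
          f-spec P (x , undecomposable)
            (h , h∈P , λ φ φ∈P → difference φ (lower (agree φ φ∈P))))
        (inter (fine (inj₁ (r h))) (diagonal* _ φf≡φh))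
      where
      Decomposes : 𝒫 κ X → Pred Carrier ℓ
      Decomposes P x = ∃[ y ] y ∈ trace P × (x - y) ∈ annihilator P

      difference : ∀ φ {x y} → ⟦ φ ⟧ x ≡ ⟦ φ ⟧ y → ⟦ φ ⟧ (x - y) ≡ 0ℤ
      difference φ {x} {y} φx≡φy = begin
        ⟦ φ ⟧ (x ∙ y ⁻¹)          ≡⟨ homo φ x (y ⁻¹) ⟩
        ⟦ φ ⟧ x +ℤ ⟦ φ ⟧ (y ⁻¹)   ≡⟨ cong₂ _+ℤ_ φx≡φy (⁻¹-homo φ y) ⟩
        ⟦ φ ⟧ y +ℤ - ⟦ φ ⟧ y      ≡⟨ ℤ.+-inverseʳ (⟦ φ ⟧ y) ⟩
        0ℤ                        ∎
        where open ≡-Reasoning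

    annihilator-isSubgroup : ∀ P → IsSubgroup H (annihilator P)
    annihilator-isSubgroup P = record
      { resp      = λ x≈y x⊥P φ φ∈P → trans (⟦⟧-cong φ (≈-sym x≈y)) (x⊥P φ φ∈P)
      ; ε-closed  = λ φ _ → ε-homo φ
      ; ∙-closed  = λ x⊥P y⊥P φ φ∈P →
          trans (homo φ _ _) (cong₂ _+ℤ_ (x⊥P φ φ∈P) (y⊥P φ φ∈P))
      ; ⁻¹-closed = λ x⊥P φ φ∈P → trans (⁻¹-homo φ _) (cong -_ (x⊥P φ φ∈P))
      }

    isDirectSummand-ae : (λ P → IsInternalSum H (trace P) (annihilator P)) ∈ 𝓤
    isDirectSummand-ae = upward
      (λ {P} ((((ε∈P , ∙-closed) , ⁻¹-closed) , disjoint) , spans) → record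
        { subgroupˡ = record
          { resp      = trace-resp P
          ; ε-closed  = ε∈P
          ; ∙-closed  = λ x∈P y∈P → ∙-closed _ x∈P _ y∈P
          ; ⁻¹-closed = ⁻¹-closed _
          }
        ; subgroupʳ = annihilator-isSubgroup P
        ; spans     = λ x → let y , y∈P , x-y⊥P = spans x in
            y , x - y , y∈P , x-y⊥P ,
            ≈-sym (≈-trans (≈-sym (AbelianGroup.assoc H y x (y ⁻¹)))
                           (xyx⁻¹≈y y x))
        ; disjoint  = disjoint _
        })
      (inter (inter (inter (inter (fine (inj₁ (r ε))) ∙-closed-ae) ⁻¹-closed-ae)
                    disjoint-ae) spans-ae)

    -- Fewer than `κ` fineness conditions hold simultaneously by completeness. With `e` injective
    -- this gives the lower bound on the size of the summand.
    image⊆trace-ae : {χ : Set ℓ} → setoid χ ≺ setoid κ → (e : χ → Carrier) →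
                     (λ P → ∀ i → e i ∈ trace P) ∈ 𝓤
    image⊆trace-ae {χ} χ≺κ e = complete χ χ≺κ _ (λ i → fine (inj₁ (r (e i))))

corollary3p2 : ∀ {ℓ : Level} → ExcludedMiddle ℓ → Extensionality ℓ ℓ →
    (κ : Set ℓ) → IsSupercompact κ →
    (H : AbelianGroup ℓ ℓ) → IsReflexive H →
    setoid κ ≼ AbelianGroup.setoid H →
    (χ : Set ℓ) → setoid χ ≺ setoid κ →
    ∃[ H′ ] IsDirectSummand H {a = ℓ} H′
    × setoid χ ≼ subsetoid (AbelianGroup.setoid H) H′
    × subsetoid (AbelianGroup.setoid H) H′ ≺ setoid κ
corollary3p2 em ext κ supercompact H reflexive κ≼H χ χ≺κ@(χ≼κ , _) =
  -- `κ` embeds in the index set through its left half, since inequivalent elements of `H` are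
  -- distinct in `Carrier`.
  let 𝓤 , μ = measure (Carrier ⊎ Hom-ℤ H)
        (mk↣ (λ eq → injective κ≼H
                       (AbelianGroup.reflexive H (inj₁-injective eq))))
      P , summand , e∈P = nonempty em (IsNormalMeasure.isUltrafilter μ)
        (IsNormalMeasure.inter μ
          (isDirectSummand-ae em H reflexive ext uncountable μ)
          (image⊆trace-ae em H reflexive ext uncountable μ χ≺κ (to χ≼H)))
  in trace em H reflexive ext uncountable μ P
   , (_ , summand)
   , record
       { to        = λ i → to χ≼H i , e∈P i
       ; cong      = cong′ χ≼H
       ; injective = injective χ≼H
       }
   , trace≺κ em H reflexive ext uncountable μ P
  where
  open IsSupercompact supercompact
  open AbelianGroup H using (Carrier) renaming (setoid to H-setoid)
  open Injection using (to; injective) renaming (cong to cong′)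

  χ≼H : setoid χ ≼ H-setoid
  χ≼H = ≼-trans {A = setoid χ} {setoid κ} {H-setoid} χ≼κ κ≼H
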